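{- Let $n\ge 0$ and $m>1$ be integers, and let $d_{n+4}=|D_{n+4}|$. Then $$d_{n+4}\equiv F(D_n^6)\equiv F\big((E^c_{n,m})^6\big)\pmod m$$ and $$d_{n+4}\equiv\sum_{a\in R_n\cap E^c_{n,m}}\ \sum_{b,c,d,e,f\in E^c_{n,m}}\gamma(a)\cdot F(a,b,c,d,e,f)\pmod m.$$
   Context: $D_n$ is the set of monotone Boolean functions $\{0,1\}^n\to\{0,1\}$ ($\{0,1\}^n$ ordered componentwise), partially ordered pointwise. $\top,\bot$ are the constant functions $1,0$; $x|y$ and $x\&y$ are pointwise max and min; $\mathrm{re}(x,y)=|\{z\in D_n:x\le z\le y\}|$. For $a,b,c,d,e,f\in D_n$ define $F(a,b,c,d,e,f)=U\cdot L$, where $$U=\sum_{u\in D_n,\ u\ge a|b|c|d|e|f}\mathrm{re}(a|b|d,u)\,\mathrm{re}(a|c|e,u)\,\mathrm{re}(b|c|f,u)\,\mathrm{re}(d|e|f,u),$$ $$L=\sum_{u\in D_n,\ u\le a\&b\&c\&d\&e\&f}\mathrm{re}(u,a\&b\&c)\,\mathrm{re}(u,a\&d\&e)\,\mathrm{re}(u,b\&d\&f)\,\mathrm{re}(u,c\&e\&f),$$ and for $A\subseteq D_n^6$, $F(A)=\sum_{(a,\dots,f)\in A}F(a,b,c,d,e,f)$. A permutation $\pi\in S_n$ acts on $g\in D_n$ by $\pi(g)=g\circ\pi$ where $\pi(u)=u\circ\pi$ for $u\in\{0,1\}^n$. $f\sim g$ iff $f=\pi(g)$ for some $\pi\in S_n$;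 $[f]$ is the class of $f$, $\gamma(f)=|[f]|$. $E_{n,m}=\{f\in D_n:\gamma(f)\equiv0\pmod m\}$, $E^c_{n,m}=D_n\setminus E_{n,m}$. $R_n$ is the set of equivalence classes, each identified with its canonical representative, namely its minimal element with respect to a fixed total order on $D_n$ (the paper uses the order obtained by reading the truth table as a binary integer); thus $R_n\subseteq D_n$ contains exactly one element of each class. -}

module Defs where

open import Data.Bool using (Bool; true; false; _∧_; _∨_; not; if_then_else_)
open import Data.Nat using (ℕ; zero; suc; _+_; _*_; _≤ᵇ_)
open import Data.Nat.Divisibility using (_∣?_)
open import Data.List using (List; []; _∷_; [_]; map; _++_; concatMap; length; filterᵇ; foldr; foldl)
open import Data.Bool.ListAction using (all; any)
open import Data.Vec using (Vec; []; _∷_; tabulate; lookup)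
open import Data.Fin using (Fin)
import Data.Fin as Fin
open import Data.List using (allFin) public
open import Data.Integer using (ℤ; +_; _-_)
import Data.Integer.Divisibility as ℤdiv
open import Relation.Nullary.Decidable using (⌊_⌋)

sumL : ∀ {A : Set} → List A → (A → ℕ) → ℕ
sumL xs g = foldr (λ x acc → g x + acc) 0 xs

_≡_[mod_] : ℕ → ℕ → ℕ → Set
x ≡ y [mod m ] = (+ m) ℤdiv.∣ ((+ x) - (+ y))

Point : ℕ → Set
Point n = Vec Bool n

BF : ℕ → Set
BF n = Point n → Bool

-- all points, in increasing binary order (first coordinate most significant,
-- false = 0, true = 1)
points : ∀ n → List (Point n)
points zero = [ [] ]
points (suc n) = map (false ∷_) (points n) ++ map (true ∷_) (points n)

-- all Boolean functions {0,1}^n → {0,1} (each exactly once, up to pointwise equality)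
allBF : ∀ n → List (BF n)
allBF zero = (λ _ → false) ∷ (λ _ → true) ∷ []
allBF (suc n) = concatMap (λ g → map (λ h → split g h) (allBF n)) (allBF n)
  where
  split : BF n → BF n → BF (suc n)
  split g h (false ∷ xs) = g xs
  split g h (true ∷ xs) = h xs

_≤b_ : Bool → Bool → Bool
false ≤b _ = true
true ≤b b = b

_==b_ : Bool → Bool → Bool
a ==b b = (a ≤b b) ∧ (b ≤b a)

_≤P_ : ∀ {n} → Point n → Point n → Bool
[] ≤P [] = true
(x ∷ xs) ≤P (y ∷ ys) = (x ≤b y) ∧ (xs ≤P ys)

isMonotone : ∀ {n} → BF n → Bool
isMonotone {n} f =
  all (λ u → all (λ v → not (u ≤P v) ∨ (f u ≤b f v)) (points n)) (points n)

D : ∀ n → List (BF n)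
D n = filterᵇ isMonotone (allBF n)

d : ℕ → ℕ
d n = length (D n)

_≤F_ : ∀ {n} → BF n → BF n → Bool
_≤F_ {n} f g = all (λ u → f u ≤b g u) (points n)

_≐_ : ∀ {n} → BF n → BF n → Bool
_≐_ {n} f g = all (λ u → f u ==b g u) (points n)

_∣∣_ : ∀ {n} → BF n → BF n → BF n
(f ∣∣ g) u = f u ∨ g u

_&_ : ∀ {n} → BF n → BF n → BF n
(f & g) u = f u ∧ g u

infixr 6 _∣∣_
infixr 7 _&_

re : ∀ {n} → BF n → BF n → ℕ
re {n} x y = length (filterᵇ (λ z → (x ≤F z) ∧ (z ≤F y)) (D n))

Upart : ∀ {n} → (a b c d e f : BF n) → ℕ
Upart {n} a b c d e f =
  sumL (filterᵇ (λ u → (a ∣∣ b ∣∣ c ∣∣ d ∣∣ e ∣∣ f) ≤F u) (D n)) λ u →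
    re (a ∣∣ b ∣∣ d) u * re (a ∣∣ c ∣∣ e) u * re (b ∣∣ c ∣∣ f) u * re (d ∣∣ e ∣∣ f) u

Lpart : ∀ {n} → (a b c d e f : BF n) → ℕ
Lpart {n} a b c d e f =
  sumL (filterᵇ (λ u → u ≤F (a & b & c & d & e & f)) (D n)) λ u →
    re u (a & b & c) * re u (a & d & e) * re u (b & d & f) * re u (c & e & f)

F : ∀ {n} → (a b c d e f : BF n) → ℕ
F a b c d e f = Upart a b c d e f * Lpart a b c d e f

F6 : ∀ {n} → List (BF n) → ℕ
F6 A = sumL A λ a → sumL A λ b → sumL A λ c → sumL A λ d → sumL A λ e → sumL A λ f →
  F a b c d e f

allVecs : ∀ {A : Set} → List A → (k : ℕ) → List (Vec A k)
allVecs xs zero = [ [] ]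
allVecs xs (suc k) = concatMap (λ x → map (x ∷_) (allVecs xs k)) xs

isInjective : ∀ {n} → Vec (Fin n) n → Bool
isInjective {n} p =
  all (λ i → all (λ j → not ⌊ lookup p i Fin.≟ lookup p j ⌋ ∨ ⌊ i Fin.≟ j ⌋) (allFin n)) (allFin n)

Sym : ∀ n → List (Vec (Fin n) n)
Sym n = filterᵇ isInjective (allVecs (allFin n) n)

actP : ∀ {n} → Vec (Fin n) n → Point n → Point n
actP π u = tabulate (λ i → lookup u (lookup π i))

act : ∀ {n} → Vec (Fin n) n → BF n → BF n
act π g u = g (actP π u)

_∼_ : ∀ {n} → BF n → BF n → Bool
_∼_ {n} f g = any (λ π → f ≐ act π g) (Sym n)

γ : ∀ {n} → BF n → ℕ
γ {n} f = length (filterᵇ (λ g → g ∼ f) (D n))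

Ec : ∀ n → ℕ → List (BF n)
Ec n m = filterᵇ (λ f → not ⌊ m ∣? γ f ⌋) (D n)

-- truth table read as a binary integer (entries listed in the order of
-- `points`, the first entry being the most significant bit)
ttNum : ∀ {n} → BF n → ℕ
ttNum {n} f = foldl (λ acc b → 2 * acc + (if b then 1 else 0)) 0 (map f (points n))

R : ∀ n → List (BF n)
R n = filterᵇ (λ f → all (λ g → not (g ∼ f) ∨ (ttNum f ≤ᵇ ttNum g)) (D n)) (D n)

REc : ∀ n → ℕ → List (BF n)
REc n m = filterᵇ (λ f → not ⌊ m ∣? γ f ⌋) (R n)

{-# OPTIONS --safe #-}
module Submission where

-- Split f ∈ D (n + 4) by its first four coordinates into 16 monotone blocks, one for each
-- S ⊆ {1,2,3,4}.  Monotonicity of f is the conjunction of the 32 inequalities along the edges of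
-- the 4-cube; once the six blocks with |S| = 2 are fixed, the blocks above them (U) and those below
-- them (L) are chosen independently, so that d (n + 4) = F6 (D n) already as natural numbers.
-- Permuting the coordinates of all six arguments preserves F.  Hence, when five arguments run over
-- permutation-invariant sets, the sum is a class function of the remaining argument, and each class
-- contributes γ times its value at the representative: a class with m ∣ γ can be dropped.

open import Defs
import Algebra.Properties.CommutativeSemigroup as CommutativeSemigroupProperties
open import Data.Bool using (Bool; true; false; _∧_; _∨_; not; if_then_else_; T)
open import Data.Bool.ListAction using (all)
open import Data.Bool.Properties using (T-∧; T-∨)
open import Data.Empty using (⊥-elim)
open import Data.Fin using (Fin; zero; suc; punchOut; #_)
import Data.Fin as Fin
open import Data.Fin.Properties using (any?; injective⇒≤; punchOut-injective)
import Data.Integer as ℤ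
import Data.Integer.Properties as ℤ
open import Data.List using (List; []; _∷_; map; _++_; concatMap; length; filterᵇ; foldl)
open import Data.List.Extrema.Nat using (argmin; argmin-all; f[argmin]≤f[xs])
open import Data.List.Membership.Propositional using (_∈_; lose; find)
open import Data.List.Membership.Propositional.Properties
  using (∈-map⁺; ∈-++⁺ˡ; ∈-++⁺ʳ; ∈-filter⁺; ∈-filter⁻; ∈-concatMap⁺; ∈-allFin)
open import Data.List.Properties using (map-cong)
import Data.List.Relation.Unary.All as ListAll
open import Data.List.Relation.Unary.All.Properties using (all⁺; all⁻)
open import Data.List.Relation.Unary.Any using (here; there)
open import Data.List.Relation.Unary.Any.Properties using (any⁺; any⁻)
open import Data.Nat using (ℕ; zero; suc; _+_; _*_; _∸_; _<_; _≤_; _≤ᵇ_)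
open import Data.Nat.Divisibility using (_∣_; _∣?_; _∣0; ∣m∣n⇒∣m+n; ∣m⇒∣m*n)
open import Data.Nat.Properties
open import Data.Product using (_×_; _,_; proj₁; proj₂; ∃)
open import Data.Sum using (inj₁; inj₂)
open import Data.Unit using (⊤; tt)
open import Data.Vec using (Vec; []; _∷_; tabulate; lookup; insertAt) renaming (_++_ to _++ᵛ_)
import Data.Vec as Vec
open import Data.Vec.Properties using (lookup∘tabulate; tabulate∘lookup; tabulate-cong; lookup-allFin)
open import Data.Vec.Relation.Binary.Pointwise.Inductive using (Pointwise; []; _∷_)
open import Data.Vec.Relation.Unary.All using (All; []; _∷_)
open import Function using (_∘_; id; const; Equivalence)
open import Function.Definitions using (Injective)
open import Relation.Binary.PropositionalEquality
open import Relation.Nullary using (yes; no; contradiction)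
open import Relation.Nullary.Decidable using (⌊_⌋; T?; toWitness; fromWitness)

open CommutativeSemigroupProperties +-commutativeSemigroup using (interchange)
  renaming (x∙yz≈y∙xz to x+[y+z]≡y+[x+z])
open CommutativeSemigroupProperties *-commutativeSemigroup
  renaming (x∙yz≈y∙xz to x*[y*z]≡y*[x*z]) using ()

private
  variable
    A B : Set
    n k : ℕ

-- Booleans as propositions and as indicator values.

𝟙 : Bool → ℕ
𝟙 b = if b then 1 else 0

T-ext : ∀ {x y} → (T x → T y) → (T y → T x) → x ≡ y
T-ext {false} {false} f g = refl
T-ext {false} {true}  f g = ⊥-elim (g tt)
T-ext {true}  {false} f g = ⊥-elim (f tt)
T-ext {true}  {true}  f g = refl

∧⁺ : ∀ {x y} → T x → T y → T (x ∧ y)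
∧⁺ p q = Equivalence.from T-∧ (p , q)

∧⁻ : ∀ x {y} → T (x ∧ y) → T x × T y
∧⁻ x = Equivalence.to (T-∧ {x})

⇒⁺ : ∀ x {y} → (T x → T y) → T (not x ∨ y)
⇒⁺ false h = tt
⇒⁺ true  h = h tt

⇒⁻ : ∀ x {y} → T (not x ∨ y) → T x → T y
⇒⁻ true h _ = h

𝟙-∧ : ∀ x y → 𝟙 (x ∧ y) ≡ 𝟙 x * 𝟙 y
𝟙-∧ false y = refl
𝟙-∧ true  y = sym (+-identityʳ (𝟙 y))

𝟙-*-cong : ∀ b {x y} → (T b → x ≡ y) → 𝟙 b * x ≡ 𝟙 b * y
𝟙-*-cong false e = refl
𝟙-*-cong true  e = cong (_+ 0) (e tt)

-- Sums over lists

sumL-cong : ∀ xs {f g : A → ℕ} → (∀ x → x ∈ xs → f x ≡ g x) → sumL xs f ≡ sumL xs g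
sumL-cong []       e = refl
sumL-cong (x ∷ xs) e = cong₂ _+_ (e x (here refl)) (sumL-cong xs λ y y∈ → e y (there y∈))

sumL-cong′ : ∀ xs {f g : A → ℕ} → (∀ x → f x ≡ g x) → sumL xs f ≡ sumL xs g
sumL-cong′ xs e = sumL-cong xs λ x _ → e x

sumL-+ : ∀ xs (f g : A → ℕ) → sumL xs (λ x → f x + g x) ≡ sumL xs f + sumL xs g
sumL-+ []       f g = refl
sumL-+ (x ∷ xs) f g = begin
  (f x + g x) + sumL xs (λ y → f y + g y)   ≡⟨ cong (f x + g x +_) (sumL-+ xs f g) ⟩
  (f x + g x) + (sumL xs f + sumL xs g)     ≡⟨ +-assoc (f x) (g x) _ ⟩
  f x + (g x + (sumL xs f + sumL xs g))     ≡⟨ cong (f x +_) (x+[y+z]≡y+[x+z] (g x) (sumL xs f) (sumL xs g)) ⟩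
  f x + (sumL xs f + (g x + sumL xs g))     ≡⟨ +-assoc (f x) _ _ ⟨
  (f x + sumL xs f) + (g x + sumL xs g)     ∎
  where
  open ≡-Reasoning

sumL-*ˡ : ∀ xs c (f : A → ℕ) → sumL xs (λ x → c * f x) ≡ c * sumL xs f
sumL-*ˡ []       c f = sym (*-zeroʳ c)
sumL-*ˡ (x ∷ xs) c f =
  trans (cong (c * f x +_) (sumL-*ˡ xs c f)) (sym (*-distribˡ-+ c (f x) _))

sumL-*ʳ : ∀ xs c (f : A → ℕ) → sumL xs (λ x → f x * c) ≡ sumL xs f * c
sumL-*ʳ xs c f = begin
  sumL xs (λ x → f x * c)  ≡⟨ sumL-cong′ xs (λ x → *-comm (f x) c) ⟩
  sumL xs (λ x → c * f x)  ≡⟨ sumL-*ˡ xs c f ⟩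
  c * sumL xs f            ≡⟨ *-comm c _ ⟩
  sumL xs f * c            ∎
  where open ≡-Reasoning

sumL-zero : (xs : List A) → sumL xs (λ _ → 0) ≡ 0
sumL-zero []       = refl
sumL-zero (x ∷ xs) = sumL-zero xs

sumL-swap : ∀ (xs : List A) (ys : List B) (f : A → B → ℕ) →
  sumL xs (λ x → sumL ys (f x)) ≡ sumL ys (λ y → sumL xs λ x → f x y)
sumL-swap []       ys f = sym (sumL-zero ys)
sumL-swap (x ∷ xs) ys f =
  trans (cong (sumL ys (f x) +_) (sumL-swap xs ys f)) (sym (sumL-+ ys (f x) _))

sumL-++ : ∀ xs ys (f : A → ℕ) → sumL (xs ++ ys) f ≡ sumL xs f + sumL ys f
sumL-++ []       ys f = refl
sumL-++ (x ∷ xs) ys f = trans (cong (f x +_) (sumL-++ xs ys f)) (sym (+-assoc (f x) _ _))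

sumL-map : ∀ xs (k : A → B) (f : B → ℕ) → sumL (map k xs) f ≡ sumL xs (f ∘ k)
sumL-map []       k f = refl
sumL-map (x ∷ xs) k f = cong (f (k x) +_) (sumL-map xs k f)

sumL-concatMap : ∀ xs (k : A → List B) (f : B → ℕ) →
  sumL (concatMap k xs) f ≡ sumL xs (λ x → sumL (k x) f)
sumL-concatMap []       k f = refl
sumL-concatMap (x ∷ xs) k f =
  trans (sumL-++ (k x) _ f) (cong (sumL (k x) f +_) (sumL-concatMap xs k f))

sumL-filter : ∀ p xs (f : A → ℕ) → sumL (filterᵇ p xs) f ≡ sumL xs (λ x → 𝟙 (p x) * f x)
sumL-filter p []       f = refl
sumL-filter p (x ∷ xs) f with p x
... | true  = cong₂ _+_ (sym (+-identityʳ (f x))) (sumL-filter p xs f)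
... | false = sumL-filter p xs f

length-filter : ∀ p (xs : List A) → length (filterᵇ p xs) ≡ sumL xs (𝟙 ∘ p)
length-filter p []       = refl
length-filter p (x ∷ xs) with p x
... | true  = cong suc (length-filter p xs)
... | false = length-filter p xs

sumL-partition : ∀ p xs (f : A → ℕ) →
  sumL xs f ≡ sumL (filterᵇ (not ∘ p) xs) f + sumL (filterᵇ p xs) f
sumL-partition p []       f = refl
sumL-partition p (x ∷ xs) f with p x
... | true  = begin
  f x + sumL xs f                                                     ≡⟨ cong (f x +_) (sumL-partition p xs f) ⟩
  f x + (sumL (filterᵇ (not ∘ p) xs) f + sumL (filterᵇ p xs) f)       ≡⟨ x+[y+z]≡y+[x+z] (f x)
                                                                           (sumL (filterᵇ (not ∘ p) xs) f)
                                                                           (sumL (filterᵇ p xs) f) ⟩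
  sumL (filterᵇ (not ∘ p) xs) f + (f x + sumL (filterᵇ p xs) f)       ∎
  where
  open ≡-Reasoning
... | false = trans (cong (f x +_) (sumL-partition p xs f)) (sym (+-assoc (f x) _ _))

-- Double counting along the relation `K`: each `g x` is multiplied by its row sum 1, the two sums
-- are swapped, `g x` becomes `h y` wherever `K` holds, and the column sums remain as weights. It
-- serves with weight 1 for permuting `D n` and with weight `γ` for passing to representatives.
sumL-transfer : ∀ (K : A → B → Bool) (w : B → ℕ) xs ys {g : A → ℕ} {h : B → ℕ} →
  (∀ x → x ∈ xs → sumL ys (λ y → 𝟙 (K x y)) ≡ 1) →
  (∀ y → y ∈ ys → sumL xs (λ x → 𝟙 (K x y)) ≡ w y) →
  (∀ x y → T (K x y) → g x ≡ h y) →
  sumL xs g ≡ sumL ys (λ y → w y * h y)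
sumL-transfer K w xs ys {g} {h} row col e = begin
  sumL xs g                                              ≡⟨ sumL-cong xs (λ x x∈ →
    trans (sym (+-identityʳ (g x))) (cong (_* g x) (sym (row x x∈)))) ⟩
  sumL xs (λ x → sumL ys (λ y → 𝟙 (K x y)) * g x)        ≡⟨ sumL-cong′ xs (λ x → sumL-*ʳ ys (g x) _) ⟨
  sumL xs (λ x → sumL ys (λ y → 𝟙 (K x y) * g x))        ≡⟨ sumL-swap xs ys _ ⟩
  sumL ys (λ y → sumL xs (λ x → 𝟙 (K x y) * g x))        ≡⟨ sumL-cong′ ys (λ y → sumL-cong′ xs λ x →
    𝟙-*-cong (K x y) (e x y)) ⟩
  sumL ys (λ y → sumL xs (λ x → 𝟙 (K x y) * h y))        ≡⟨ sumL-cong′ ys (λ y → sumL-*ʳ xs (h y) _) ⟩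
  sumL ys (λ y → sumL xs (λ x → 𝟙 (K x y)) * h y)        ≡⟨ sumL-cong ys (λ y y∈ → cong (_* h y) (col y y∈)) ⟩
  sumL ys (λ y → w y * h y)                              ∎
  where open ≡-Reasoning

-- Monotone functions

≤b⁺ : ∀ {x y} → (T x → T y) → T (x ≤b y)
≤b⁺ {false} f = tt
≤b⁺ {true}  f = f tt

≤b⁻ : ∀ {x y} → T (x ≤b y) → T x → T y
≤b⁻ {true} p _ = p

==b⁺ : ∀ {x y} → x ≡ y → T (x ==b y)
==b⁺ {false} refl = tt
==b⁺ {true}  refl = tt

==b⁻ : ∀ {x y} → T (x ==b y) → x ≡ y
==b⁻ {false} {false} _ = refl
==b⁻ {true}  {true}  _ = refl

∈-points : (u : Point n) → u ∈ points n
∈-points []          = here refl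
∈-points (false ∷ u) = ∈-++⁺ˡ (∈-map⁺ (false ∷_) (∈-points u))
∈-points (true ∷ u)  = ∈-++⁺ʳ (map (false ∷_) (points _)) (∈-map⁺ (true ∷_) (∈-points u))

all-points⁺ : {p : Point n → Bool} → (∀ u → T (p u)) → T (all p (points n))
all-points⁺ {n} h = all⁻ _ (ListAll.tabulate {xs = points n} λ {u} _ → h u)

all-points⁻ : (p : Point n → Bool) → T (all p (points n)) → ∀ u → T (p u)
all-points⁻ p h u = ListAll.lookup (all⁺ p (points _) h) (∈-points u)

infix 4 _⊑_

_⊑_ : BF n → BF n → Set
f ⊑ g = ∀ u → T (f u) → T (g u)

Mono : BF n → Set
Mono f = ∀ u v → T (u ≤P v) → T (f u) → T (f v)

≐⁺ : (f g : BF n) → f ≗ g → T (f ≐ g)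
≐⁺ f g e = all-points⁺ λ u → ==b⁺ (e u)

≐⁻ : (f g : BF n) → T (f ≐ g) → f ≗ g
≐⁻ f g e u = ==b⁻ (all-points⁻ (λ v → f v ==b g v) e u)

≤F⁺ : (f g : BF n) → f ⊑ g → T (f ≤F g)
≤F⁺ f g e = all-points⁺ λ u → ≤b⁺ (e u)

≤F⁻ : (f g : BF n) → T (f ≤F g) → f ⊑ g
≤F⁻ f g e u = ≤b⁻ (all-points⁻ (λ v → f v ≤b g v) e u)

isMonotone⁺ : (f : BF n) → Mono f → T (isMonotone f)
isMonotone⁺ f m = all-points⁺ λ u → all-points⁺ λ v → ⇒⁺ (u ≤P v) λ p → ≤b⁺ (m u v p)

isMonotone⁻ : (f : BF n) → T (isMonotone f) → Mono f
isMonotone⁻ f h u v p = ≤b⁻ (⇒⁻ (u ≤P v) (all-points⁻ _ (all-points⁻ step h u) v) p)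
  where
  step : Point _ → Bool
  step u = all (λ v → not (u ≤P v) ∨ (f u ≤b f v)) (points _)

∈D⇒Mono : {f : BF n} → f ∈ D n → Mono f
∈D⇒Mono {n} {f} f∈ = isMonotone⁻ f (proj₂ (∈-filter⁻ (T? ∘ isMonotone) {xs = allBF n} f∈))

Mono-≗ : {f g : BF n} → f ≗ g → Mono f → Mono g
Mono-≗ e m u v p t = subst T (e v) (m u v p (subst T (sym (e u)) t))

-- A counterpart of the gluing local to `allBF`, with which it agrees pointwise; hence the
-- hypothesis `Extensional` in `sumL-allBF-suc`.
_▹_ : BF n → BF n → BF (suc n)
(g ▹ h) (false ∷ u) = g u
(g ▹ h) (true ∷ u)  = h u

▹-cong : {f f′ g g′ : BF n} → f ≗ f′ → g ≗ g′ → f ▹ g ≗ f′ ▹ g′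
▹-cong p q (false ∷ u) = p u
▹-cong p q (true ∷ u)  = q u

Extensional : (BF n → ℕ) → Set
Extensional φ = ∀ {f g} → f ≗ g → φ f ≡ φ g

sumL-allBF-suc : ∀ {φ : BF (suc n) → ℕ} → Extensional φ →
  sumL (allBF (suc n)) φ ≡ sumL (allBF n) λ g → sumL (allBF n) λ h → φ (g ▹ h)
sumL-allBF-suc {n} ext = trans (sumL-concatMap (allBF n) _ _) (sumL-cong′ (allBF n) λ g →
  trans (sumL-map (allBF n) _ _) (sumL-cong′ (allBF n) λ h → ext λ where
    (false ∷ u) → refl
    (true ∷ u)  → refl))

≐-extˡ : (k : BF n) → Extensional λ f → 𝟙 (f ≐ k)
≐-extˡ k {f} {g} e = cong 𝟙 (T-ext
  (λ p → ≐⁺ g k λ u → trans (sym (e u)) (≐⁻ f k p u))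
  (λ p → ≐⁺ f k λ u → trans (e u) (≐⁻ g k p u)))

-- `allBF` lists every function once up to `≐`. Equality with `k` is equality on both halves, so the
-- double sum over halves factors and induction applies to each factor.
count-allBF : (k : BF n) → sumL (allBF n) (λ f → 𝟙 (f ≐ k)) ≡ 1
count-allBF {zero} k with k []
... | false = refl
... | true  = refl
count-allBF {suc n} k = begin
  sumL (allBF (suc n)) (λ f → 𝟙 (f ≐ k))
    ≡⟨ sumL-allBF-suc (≐-extˡ k) ⟩
  sumL (allBF n) (λ g → sumL (allBF n) λ h → 𝟙 ((g ▹ h) ≐ k))
    ≡⟨ sumL-cong′ (allBF n) (λ g → sumL-cong′ (allBF n) λ h →
         trans (cong 𝟙 (≐-▹ g h)) (𝟙-∧ (g ≐ k₀) (h ≐ k₁))) ⟩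
  sumL (allBF n) (λ g → sumL (allBF n) λ h → 𝟙 (g ≐ k₀) * 𝟙 (h ≐ k₁))
    ≡⟨ sumL-cong′ (allBF n) (λ g → trans (sumL-*ˡ (allBF n) (𝟙 (g ≐ k₀)) _)
         (trans (cong (𝟙 (g ≐ k₀) *_) (count-allBF k₁)) (*-identityʳ _))) ⟩
  sumL (allBF n) (λ g → 𝟙 (g ≐ k₀))
    ≡⟨ count-allBF k₀ ⟩
  1 ∎
  where
  open ≡-Reasoning
  k₀ = λ u → k (false ∷ u)
  k₁ = λ u → k (true ∷ u)
  ≐-▹ : ∀ g h → ((g ▹ h) ≐ k) ≡ ((g ≐ k₀) ∧ (h ≐ k₁))
  ≐-▹ g h = T-ext
    (λ p → ∧⁺ (≐⁺ g k₀ λ u → ≐⁻ (g ▹ h) k p (false ∷ u))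
              (≐⁺ h k₁ λ u → ≐⁻ (g ▹ h) k p (true ∷ u)))
    (λ p → ≐⁺ (g ▹ h) k λ where
      (false ∷ u) → ≐⁻ g k₀ (proj₁ (∧⁻ (g ≐ k₀) p)) u
      (true ∷ u)  → ≐⁻ h k₁ (proj₂ (∧⁻ (g ≐ k₀) p)) u)

-- A function pointwise equal to the monotone `g` is itself monotone, so the filter loses none of
-- the matches counted by `count-allBF`.
count-D : {g : BF n} → Mono g → sumL (D n) (λ f → 𝟙 (f ≐ g)) ≡ 1
count-D {n} {g} m = begin
  sumL (D n) (λ f → 𝟙 (f ≐ g))                               ≡⟨ sumL-filter isMonotone (allBF n) _ ⟩
  sumL (allBF n) (λ f → 𝟙 (isMonotone f) * 𝟙 (f ≐ g))        ≡⟨ sumL-cong′ (allBF n) (λ f →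
    trans (sym (𝟙-∧ (isMonotone f) (f ≐ g))) (cong 𝟙 (T-ext
      (λ p → proj₂ (∧⁻ (isMonotone f) p))
      (λ p → ∧⁺ (isMonotone⁺ f (Mono-≗ (λ u → sym (≐⁻ f g p u)) m)) p)))) ⟩
  sumL (allBF n) (λ f → 𝟙 (f ≐ g))                           ≡⟨ count-allBF g ⟩
  1                                                          ∎
  where open ≡-Reasoning

-- Permutations of the coordinates

-- Pigeonhole: if `j` were missed, punching `j` out of the codomain would inject `Fin (suc n)` into
-- `Fin n`.
injective⇒surjective : {f : Fin n → Fin n} → Injective _≡_ _≡_ f → ∀ j → ∃ λ i → f i ≡ j
injective⇒surjective {suc n} {f} inj j with any? (λ i → f i Fin.≟ j)
... | yes hit = hit
... | no miss = contradiction (injective⇒≤ {f = λ i → punchOut (avoid i)}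
    λ {i} {i′} e → inj (punchOut-injective (avoid i) (avoid i′) e)) 1+n≰n
  where
  avoid : ∀ i → j ≢ f i
  avoid i e = miss (i , sym e)

record Perm (n : ℕ) : Set where
  constructor perm
  field
    vec       : Vec (Fin n) n
    injective : Injective _≡_ _≡_ (lookup vec)

  at : Fin n → Fin n
  at = lookup vec

  move : Point n → Point n
  move = actP vec

open Perm

idᵖ : Perm n
idᵖ = perm (Vec.allFin _) λ {i} {j} e →
  trans (sym (lookup-allFin i)) (trans e (lookup-allFin j))

_∘ᵖ_ : Perm n → Perm n → Perm n
π ∘ᵖ ρ = perm (tabulate (at π ∘ at ρ)) λ {i} {j} e → injective ρ (injective π
  (trans (sym (lookup∘tabulate _ i)) (trans e (lookup∘tabulate _ j))))

module _ (π : Perm n) where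
  preimage : ∀ j → ∃ λ i → at π i ≡ j
  preimage = injective⇒surjective (injective π)

  inverse : Vec (Fin n) n
  inverse = tabulate (proj₁ ∘ preimage)

  at-inverse : ∀ j → at π (lookup inverse j) ≡ j
  at-inverse j = trans (cong (at π) (lookup∘tabulate _ j)) (proj₂ (preimage j))

_⁻¹ : Perm n → Perm n
π ⁻¹ = perm (inverse π) λ {i} {j} e →
  trans (sym (at-inverse π i)) (trans (cong (at π) e) (at-inverse π j))

at-⁻¹ˡ : (π : Perm n) → ∀ i → at (π ⁻¹) (at π i) ≡ i
at-⁻¹ˡ π i = injective π (at-inverse π (at π i))

move-idᵖ : (u : Point n) → move idᵖ u ≡ u
move-idᵖ u = trans (tabulate-cong λ i → cong (lookup u) (lookup-allFin i)) (tabulate∘lookup u)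

-- On points the order of composition is reversed; precomposition reverses it again, so
-- `(π ∘ᵖ ρ) · h` is `π · (ρ · h)` and `≈-trans` composes in the written order.
move-∘ᵖ : (π ρ : Perm n) → ∀ u → move (π ∘ᵖ ρ) u ≡ move ρ (move π u)
move-∘ᵖ π ρ u = tabulate-cong λ i →
  trans (cong (lookup u) (lookup∘tabulate _ i)) (sym (lookup∘tabulate _ (at ρ i)))

move-inverse : (π ρ : Perm n) → (∀ i → at ρ (at π i) ≡ i) → ∀ u → move π (move ρ u) ≡ u
move-inverse π ρ inv u = trans
  (tabulate-cong λ i → trans (lookup∘tabulate _ (at π i)) (cong (lookup u) (inv i)))
  (tabulate∘lookup u)

≤P⁺ : (u v : Point n) → (∀ i → T (lookup u i ≤b lookup v i)) → T (u ≤P v)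
≤P⁺ []      []      h = tt
≤P⁺ (x ∷ u) (y ∷ v) h = ∧⁺ (h zero) (≤P⁺ u v (h ∘ suc))

≤P⁻ : (u v : Point n) → T (u ≤P v) → ∀ i → T (lookup u i ≤b lookup v i)
≤P⁻ (x ∷ u) (y ∷ v) h zero    = proj₁ (∧⁻ (x ≤b y) h)
≤P⁻ (x ∷ u) (y ∷ v) h (suc i) = ≤P⁻ u v (proj₂ (∧⁻ (x ≤b y) h)) i

move-mono : (π : Perm n) (u v : Point n) → T (u ≤P v) → T (move π u ≤P move π v)
move-mono π u v h = ≤P⁺ (move π u) (move π v) λ i →
  subst₂ (λ x y → T (x ≤b y))
    (sym (lookup∘tabulate (lookup u ∘ at π) i)) (sym (lookup∘tabulate (lookup v ∘ at π) i))
    (≤P⁻ u v h (at π i))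

_·_ : Perm n → BF n → BF n
π · f = act (vec π) f

Mono-· : (π : Perm n) {f : BF n} → Mono f → Mono (π · f)
Mono-· π m u v p = m (move π u) (move π v) (move-mono π u v p)

-- A relation rather than an equation `f = π · g`: it is pointwise, so `∣∣` and `&` preserve it by
-- plain congruence.
_≈[_]_ : BF n → Perm n → BF n → Set
f ≈[ π ] g = f ≗ π · g

≈-sym : {π : Perm n} {f g : BF n} → f ≈[ π ] g → g ≈[ π ⁻¹ ] f
≈-sym {π = π} {f} {g} e u =
  trans (cong g (sym (move-inverse π (π ⁻¹) (at-⁻¹ˡ π) u))) (sym (e (move (π ⁻¹) u)))

≈-flip : {π : Perm n} {f g : BF n} → g ≈[ π ⁻¹ ] f → f ≈[ π ] g
≈-flip {π = π} {f} {g} e u =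
  trans (cong f (sym (move-inverse (π ⁻¹) π (at-inverse π) u))) (sym (e (move π u)))

≈-trans : {π ρ : Perm n} {f g h : BF n} → f ≈[ π ] g → g ≈[ ρ ] h → f ≈[ π ∘ᵖ ρ ] h
≈-trans {π = π} {ρ} {h = h} p q u =
  trans (p u) (trans (q (move π u)) (cong h (sym (move-∘ᵖ π ρ u))))

∈-allVecs : ∀ xs → (∀ (x : A) → x ∈ xs) → ∀ (v : Vec A k) → v ∈ allVecs xs k
∈-allVecs xs h []      = here refl
∈-allVecs xs h (x ∷ v) = ∈-concatMap⁺ _ (lose (h x) (∈-map⁺ (x ∷_) (∈-allVecs xs h v)))

isInjective⁺ : (p : Vec (Fin n) n) → Injective _≡_ _≡_ (lookup p) → T (isInjective p)
isInjective⁺ {n} p inj =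
  all⁻ _ (ListAll.tabulate {xs = allFin n} λ {i} _ → all⁻ _ (ListAll.tabulate {xs = allFin n} λ {j} _ → imp i j))
  where
  imp : ∀ i j → T (not ⌊ lookup p i Fin.≟ lookup p j ⌋ ∨ ⌊ i Fin.≟ j ⌋)
  imp i j with lookup p i Fin.≟ lookup p j
  ... | yes e = fromWitness (inj e)
  ... | no _  = tt

isInjective⁻ : (p : Vec (Fin n) n) → T (isInjective p) → Injective _≡_ _≡_ (lookup p)
isInjective⁻ {n} p h {i} {j} e = imp (ListAll.lookup (all⁺ (test i) (allFin n)
    (ListAll.lookup (all⁺ (λ i → all (test i) (allFin n)) (allFin n) h) (∈-allFin i))) (∈-allFin j))
  where
  test : Fin n → Fin n → Bool
  test i j = not ⌊ lookup p i Fin.≟ lookup p j ⌋ ∨ ⌊ i Fin.≟ j ⌋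
  imp : T (test i j) → i ≡ j
  imp t with lookup p i Fin.≟ lookup p j
  ... | yes _ = toWitness t
  ... | no ne = contradiction e ne

∼⁺ : (π : Perm n) (f g : BF n) → f ≈[ π ] g → T (f ∼ g)
∼⁺ {n} π f g e = any⁺ (λ ρ → f ≐ act ρ g) (lose
  (∈-filter⁺ (T? ∘ isInjective) (∈-allVecs (allFin n) ∈-allFin (vec π)) (isInjective⁺ (vec π) (injective π)))
  (≐⁺ f (π · g) e))

∼⁻ : (f g : BF n) → T (f ∼ g) → ∃ λ π → f ≈[ π ] g
∼⁻ {n} f g h with find (any⁻ (λ ρ → f ≐ act ρ g) (Sym n) h)
... | ρ , ρ∈ , e = perm ρ (isInjective⁻ ρ inj) , ≐⁻ f (act ρ g) e
  where inj = proj₂ (∈-filter⁻ (T? ∘ isInjective) {xs = allVecs (allFin n) n} ρ∈)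

∼-sym : (f g : BF n) → T (f ∼ g) → T (g ∼ f)
∼-sym f g p = let π , e = ∼⁻ f g p in ∼⁺ (π ⁻¹) g f (≈-sym {π = π} e)

∼-trans : (f g h : BF n) → T (f ∼ g) → T (g ∼ h) → T (f ∼ h)
∼-trans f g h p q =
  let π , e = ∼⁻ f g p ; ρ , e′ = ∼⁻ g h q in
  ∼⁺ (π ∘ᵖ ρ) f h (≈-trans {π = π} {ρ} {h = h} e e′)

-- Invariance under a simultaneous permutation of the arguments

Matches : Perm n → (BF n → A) → (BF n → A) → Set
Matches π φ ψ = ∀ f g → f ≈[ π ] g → φ f ≡ ψ g

-- Invariance of `X` under `π`, phrased through sums: multiplicities count, entries matter only up
-- to `≗`, and having two summands lets the property pass under nested sums.
Closed : Perm n → List (BF n) → Set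
Closed π X = ∀ φ ψ → Matches π φ ψ → sumL X φ ≡ sumL X ψ

-- The relation `f ≐ (π · g)` is a bijection of `D n` up to `≐`: for given `f` the only partner is
-- `(π ⁻¹) · f`, for given `g` it is `π · g`. All row and column sums are therefore 1.
D-closed : (π : Perm n) → Closed π (D n)
D-closed {n} π φ ψ m = trans
  (sumL-transfer (λ f g → f ≐ (π · g)) (const 1) (D n) (D n) {h = ψ}
    (λ f f∈ → trans (sumL-cong′ (D n) λ g → cong 𝟙 (flip f g))
                    (count-D {g = (π ⁻¹) · f} (Mono-· (π ⁻¹) {f} (∈D⇒Mono f∈))))
    (λ g g∈ → count-D {g = π · g} (Mono-· π {g} (∈D⇒Mono g∈)))
    (λ f g t → m f g (≐⁻ f (π · g) t)))
  (sumL-cong′ (D n) λ g → *-identityˡ (ψ g))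
  where
  flip : ∀ f g → (f ≐ (π · g)) ≡ (g ≐ ((π ⁻¹) · f))
  flip f g = T-ext
    (λ t → ≐⁺ g ((π ⁻¹) · f) (≈-sym {π = π} (≐⁻ f (π · g) t)))
    (λ t → ≐⁺ f (π · g) (≈-flip {π = π} (≐⁻ g ((π ⁻¹) · f) t)))

sumL-filter-D : (π : Perm n) {p q : BF n → Bool} {φ ψ : BF n → ℕ} →
  Matches π p q → Matches π φ ψ → sumL (filterᵇ p (D n)) φ ≡ sumL (filterᵇ q (D n)) ψ
sumL-filter-D {n} π {p} {q} {φ} {ψ} mp mφ = begin
  sumL (filterᵇ p (D n)) φ              ≡⟨ sumL-filter p (D n) φ ⟩
  sumL (D n) (λ f → 𝟙 (p f) * φ f)      ≡⟨ D-closed π _ _ (λ f g e →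
                                             cong₂ (λ b x → 𝟙 b * x) (mp f g e) (mφ f g e)) ⟩
  sumL (D n) (λ g → 𝟙 (q g) * ψ g)      ≡⟨ sumL-filter q (D n) ψ ⟨
  sumL (filterᵇ q (D n)) ψ              ∎
  where open ≡-Reasoning

module _ (π : Perm n) where

  private
    infix 4 _≈_
    _≈_ : BF n → BF n → Set
    f ≈ g = f ≈[ π ] g

  ≤F-≈ : ∀ {x x′ y y′} → x ≈ x′ → y ≈ y′ → (x ≤F y) ≡ (x′ ≤F y′)
  ≤F-≈ {x} {x′} {y} {y′} p q = T-ext
    (λ t → ≤F⁺ x′ y′ λ u s → subst T (sym (≈-sym {π = π} q u))
      (≤F⁻ x y t (move (π ⁻¹) u) (subst T (≈-sym {π = π} p u) s)))
    (λ t → ≤F⁺ x y λ u s → subst T (sym (q u)) (≤F⁻ x′ y′ t (move π u) (subst T (p u) s)))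

  re-≈ : ∀ {x x′ y y′} → x ≈ x′ → y ≈ y′ → re x y ≡ re x′ y′
  re-≈ {x} {x′} {y} {y′} p q = begin
    re x y                                            ≡⟨ length-filter _ (D n) ⟩
    sumL (D n) (λ z → 𝟙 ((x ≤F z) ∧ (z ≤F y)))        ≡⟨ D-closed π _ _ (λ z z′ e →
      cong 𝟙 (cong₂ _∧_ (≤F-≈ {x} {x′} p e) (≤F-≈ {z} {z′} e q))) ⟩
    sumL (D n) (λ z → 𝟙 ((x′ ≤F z) ∧ (z ≤F y′)))      ≡⟨ length-filter _ (D n) ⟨
    re x′ y′                                          ∎
    where open ≡-Reasoning

  -- A permutation of coordinates is an automorphism of the lattice `D n`, and `F` is built from
  -- joins, meets, the order and sums over `D n`.
  F-≈ : ∀ {a b c d e f a′ b′ c′ d′ e′ f′} →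
    a ≈ a′ → b ≈ b′ → c ≈ c′ → d ≈ d′ → e ≈ e′ → f ≈ f′ → F a b c d e f ≡ F a′ b′ c′ d′ e′ f′
  F-≈ {a} {b} {c} {d} {e} {f} {a′} {b′} {c′} {d′} {e′} {f′} p q r s t w = cong₂ _*_
    (sumL-filter-D π
      (λ u u′ z → ≤F-≈ {a ∣∣ b ∣∣ c ∣∣ d ∣∣ e ∣∣ f} {a′ ∣∣ b′ ∣∣ c′ ∣∣ d′ ∣∣ e′ ∣∣ f′}
        (λ x → cong₂ _∨_ (p x) (∨₅ x)) z)
      (λ u u′ z → cong₂ _*_ (cong₂ _*_ (cong₂ _*_
        (re-≈ {a ∣∣ b ∣∣ d} {a′ ∣∣ b′ ∣∣ d′} (λ x → cong₂ _∨_ (p x) (cong₂ _∨_ (q x) (s x))) z)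
        (re-≈ {a ∣∣ c ∣∣ e} {a′ ∣∣ c′ ∣∣ e′} (λ x → cong₂ _∨_ (p x) (cong₂ _∨_ (r x) (t x))) z))
        (re-≈ {b ∣∣ c ∣∣ f} {b′ ∣∣ c′ ∣∣ f′} (λ x → cong₂ _∨_ (q x) (cong₂ _∨_ (r x) (w x))) z))
        (re-≈ {d ∣∣ e ∣∣ f} {d′ ∣∣ e′ ∣∣ f′} (λ x → cong₂ _∨_ (s x) (cong₂ _∨_ (t x) (w x))) z)))
    (sumL-filter-D π
      (λ u u′ z → ≤F-≈ {u} {u′} z (λ x → cong₂ _∧_ (p x) (∧₅ x)))
      (λ u u′ z → cong₂ _*_ (cong₂ _*_ (cong₂ _*_
        (re-≈ {u} {u′} z (λ x → cong₂ _∧_ (p x) (cong₂ _∧_ (q x) (r x))))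
        (re-≈ {u} {u′} z (λ x → cong₂ _∧_ (p x) (cong₂ _∧_ (s x) (t x)))))
        (re-≈ {u} {u′} z (λ x → cong₂ _∧_ (q x) (cong₂ _∧_ (s x) (w x)))))
        (re-≈ {u} {u′} z (λ x → cong₂ _∧_ (r x) (cong₂ _∧_ (t x) (w x))))))
    where
    ∨₅ = λ x → cong₂ _∨_ (q x) (cong₂ _∨_ (r x) (cong₂ _∨_ (s x) (cong₂ _∨_ (t x) (w x))))
    ∧₅ = λ x → cong₂ _∧_ (q x) (cong₂ _∧_ (r x) (cong₂ _∧_ (s x) (cong₂ _∧_ (t x) (w x))))

γ-∼ : (f g : BF n) → T (f ∼ g) → γ f ≡ γ g
γ-∼ {n} f g f∼g = begin
  γ f                              ≡⟨ length-filter _ (D n) ⟩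
  sumL (D n) (λ h → 𝟙 (h ∼ f))     ≡⟨ sumL-cong′ (D n) (λ h → cong 𝟙 (T-ext
    (λ p → ∼-trans h f g p f∼g) (λ p → ∼-trans h g f p (∼-sym f g f∼g)))) ⟩
  sumL (D n) (λ h → 𝟙 (h ∼ g))     ≡⟨ length-filter _ (D n) ⟨
  γ g                              ∎
  where open ≡-Reasoning

-- Orbits and their representatives

binary-injective : ∀ a a′ b b′ → 2 * a + 𝟙 b ≡ 2 * a′ + 𝟙 b′ → a ≡ a′ × b ≡ b′
binary-injective a a′ false false e = *-cancelˡ-≡ a a′ 2 (+-cancelʳ-≡ 0 (2 * a) (2 * a′) e) , refl
binary-injective a a′ true  true  e = *-cancelˡ-≡ a a′ 2 (+-cancelʳ-≡ 1 (2 * a) (2 * a′) e) , refl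
binary-injective a a′ false true  e =
  contradiction (trans (sym (+-identityʳ (2 * a))) (trans e (+-comm (2 * a′) 1))) (even≢odd a a′)
binary-injective a a′ true  false e =
  contradiction (trans (sym (+-identityʳ (2 * a′))) (trans (sym e) (+-comm (2 * a) 1))) (even≢odd a′ a)

-- The accumulators vary, so the induction hypothesis can be used after the first digit has been
-- absorbed; it equates the new accumulators, from which `binary-injective` recovers the old ones
-- and the digit.
foldl-binary-injective : ∀ (us : List A) (f g : A → Bool) a a′ →
  let step = λ acc b → 2 * acc + (if b then 1 else 0) in
  foldl step a (map f us) ≡ foldl step a′ (map g us) →
  a ≡ a′ × ListAll.All (λ u → f u ≡ g u) us
foldl-binary-injective []       f g a a′ e = e , ListAll.[]
foldl-binary-injective (u ∷ us) f g a a′ e =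
  let e₁ , es = foldl-binary-injective us f g _ _ e
      e₂ , e₃ = binary-injective a a′ (f u) (g u) e₁
  in  e₂ , e₃ ListAll.∷ es

-- Makes the truth-table order antisymmetric up to `≗`, so that a class has only one minimal
-- element.
ttNum-injective : (f g : BF n) → ttNum f ≡ ttNum g → f ≗ g
ttNum-injective {n} f g e u =
  ListAll.lookup (proj₂ (foldl-binary-injective (points n) f g 0 0 e)) (∈-points u)

ttNum-cong : (f g : BF n) → f ≗ g → ttNum f ≡ ttNum g
ttNum-cong {n} f g e = cong (foldl _ 0) (map-cong e (points n))

≗⇒∼ : (f g : BF n) → f ≗ g → T (f ∼ g)
≗⇒∼ f g e = ∼⁺ idᵖ f g λ u → trans (e u) (cong g (sym (move-idᵖ u)))

isRep : BF n → Bool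
isRep {n} f = all (λ g → not (g ∼ f) ∨ (ttNum f ≤ᵇ ttNum g)) (D n)

IsRep : BF n → Set
IsRep {n} f = ∀ g → g ∈ D n → T (g ∼ f) → ttNum f ≤ ttNum g

isRep⁺ : (f : BF n) → IsRep f → T (isRep f)
isRep⁺ {n} f h = all⁻ _ (ListAll.tabulate {xs = D n} λ {g} g∈ → ⇒⁺ (g ∼ f) λ t → ≤⇒≤ᵇ (h g g∈ t))

isRep⁻ : (f : BF n) → T (isRep f) → IsRep f
isRep⁻ {n} f h g g∈ t = ≤ᵇ⇒≤ _ _ (⇒⁻ (g ∼ f) (ListAll.lookup (all⁺ _ (D n) h) g∈) t)

representative : (f : BF n) → f ∈ D n → ∃ λ r → r ∈ D n × T (f ∼ r) × IsRep r
representative {n} f f∈ = r , proj₁ r-ok , ∼-sym r f (proj₂ r-ok) , λ g g∈ g∼r →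
  ListAll.lookup (f[argmin]≤f[xs] f orbit)
    (∈-filter⁺ (λ g → T? (g ∼ f)) g∈ (∼-trans g r f g∼r (proj₂ r-ok)))
  where
  orbit = filterᵇ (_∼ f) (D n)
  -- The default `f` lies in its own class, so the minimiser is in the class whichever entry it
  -- comes from.
  r = argmin ttNum f orbit
  r-ok : r ∈ D n × T (r ∼ f)
  r-ok = argmin-all ttNum {P = λ g → g ∈ D n × T (g ∼ f)} (f∈ , ≗⇒∼ f f λ _ → refl)
    (ListAll.tabulate λ g∈ → ∈-filter⁻ (λ g → T? (g ∼ f)) {xs = D n} g∈)

-- Two representatives related to `f` bound each other's `ttNum` and thus agree pointwise. Hence
-- being a representative of the class of `f` amounts to being `≐` to the `r₀` found by
-- minimisation, and `count-D` applies.
count-R : (f : BF n) → f ∈ D n → sumL (R n) (λ r → 𝟙 (f ∼ r)) ≡ 1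
count-R {n} f f∈ = begin
  sumL (R n) (λ r → 𝟙 (f ∼ r))                     ≡⟨ sumL-filter isRep (D n) _ ⟩
  sumL (D n) (λ r → 𝟙 (isRep r) * 𝟙 (f ∼ r))       ≡⟨ sumL-cong (D n) (λ r r∈ →
    trans (sym (𝟙-∧ (isRep r) (f ∼ r))) (cong 𝟙 (T-ext (unique r r∈) (rep r)))) ⟩
  sumL (D n) (λ r → 𝟙 (r ≐ r₀))                    ≡⟨ count-D {g = r₀} (∈D⇒Mono r₀∈) ⟩
  1                                                ∎
  where
  open ≡-Reasoning
  r₀ = proj₁ (representative f f∈)
  r₀∈ = proj₁ (proj₂ (representative f f∈))
  f∼r₀ = proj₁ (proj₂ (proj₂ (representative f f∈)))
  rep₀ = proj₂ (proj₂ (proj₂ (representative f f∈)))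
  unique : ∀ r → r ∈ D n → T (isRep r ∧ (f ∼ r)) → T (r ≐ r₀)
  unique r r∈ t = ≐⁺ r r₀ (ttNum-injective r r₀ (≤-antisym
    (isRep⁻ r (proj₁ (∧⁻ (isRep r) t)) r₀ r₀∈ (∼-trans r₀ f r (∼-sym f r₀ f∼r₀) f∼r))
    (rep₀ r r∈ (∼-trans r f r₀ (∼-sym f r f∼r) f∼r₀))))
    where f∼r = proj₂ (∧⁻ (isRep r) t)
  rep : ∀ r → T (r ≐ r₀) → T (isRep r ∧ (f ∼ r))
  rep r t = ∧⁺ (isRep⁺ r λ g g∈ g∼r →
      subst (_≤ ttNum g) (sym (ttNum-cong r r₀ r≗r₀)) (rep₀ g g∈ (∼-trans g r r₀ g∼r r∼r₀)))
    (∼-trans f r₀ r f∼r₀ (∼-sym r r₀ r∼r₀))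
    where
    r≗r₀ = ≐⁻ r r₀ t
    r∼r₀ = ≗⇒∼ r r₀ r≗r₀

Invariant : (BF n → A) → Set
Invariant φ = ∀ f g → T (f ∼ g) → φ f ≡ φ g

-- Transfer along `∼` from `D n` to `R n`: each `f` has one representative, and the number of `f`
-- related to `r` is `γ r` by definition.
sumL-orbits : (p : BF n → Bool) (φ : BF n → ℕ) → Invariant p → Invariant φ →
  sumL (filterᵇ p (D n)) φ ≡ sumL (filterᵇ p (R n)) (λ r → γ r * φ r)
sumL-orbits {n} p φ pinv φinv = begin
  sumL (filterᵇ p (D n)) φ                       ≡⟨ sumL-filter p (D n) φ ⟩
  sumL (D n) (λ f → 𝟙 (p f) * φ f)               ≡⟨ sumL-transfer _∼_ γ (D n) (R n)
    count-R (λ r _ → sym (length-filter _ (D n)))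
    (λ f r t → cong₂ (λ b x → 𝟙 b * x) (pinv f r t) (φinv f r t)) ⟩
  sumL (R n) (λ r → γ r * (𝟙 (p r) * φ r))       ≡⟨ sumL-cong′ (R n) (λ r →
    x*[y*z]≡y*[x*z] (γ r) (𝟙 (p r)) (φ r)) ⟩
  sumL (R n) (λ r → 𝟙 (p r) * (γ r * φ r))       ≡⟨ sumL-filter p (R n) _ ⟨
  sumL (filterᵇ p (R n)) (λ r → γ r * φ r)       ∎
  where
  open ≡-Reasoning

-- Dropping multiples of m

-- A one-sided congruence: what is dropped is a natural number divisible by `m`, so subtraction is
-- avoided until `↘⇒mod`.
_↘[_]_ : ℕ → ℕ → ℕ → Set
x ↘[ m ] y = ∃ λ z → m ∣ z × x ≡ y + z

↘-trans : ∀ {m x y z} → x ↘[ m ] y → y ↘[ m ] z → x ↘[ m ] z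
↘-trans {z = z} (p , m∣p , refl) (q , m∣q , refl) = q + p , ∣m∣n⇒∣m+n m∣q m∣p , +-assoc z q p

sumL-↘ : ∀ {m} xs {φ ψ : A → ℕ} → (∀ x → φ x ↘[ m ] ψ x) → sumL xs φ ↘[ m ] sumL xs ψ
sumL-↘ []       h = 0 , _ ∣0 , refl
sumL-↘ (x ∷ xs) {φ} {ψ} h with h x | sumL-↘ xs h
... | p , m∣p , e | q , m∣q , e′ = p + q , ∣m∣n⇒∣m+n m∣p m∣q ,
  trans (cong₂ _+_ e e′) (interchange (ψ x) p (sumL xs ψ) q)

sumL-∣ : ∀ {m} xs {φ : A → ℕ} → (∀ x → x ∈ xs → m ∣ φ x) → m ∣ sumL xs φ
sumL-∣ []       h = _ ∣0
sumL-∣ (x ∷ xs) h = ∣m∣n⇒∣m+n (h x (here refl)) (sumL-∣ xs λ y y∈ → h y (there y∈))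

divisible : ℕ → BF n → Bool
divisible m f = ⌊ m ∣? γ f ⌋

divisible-invariant : ∀ m → Invariant (divisible {n} m)
divisible-invariant m f g t = cong (λ k → ⌊ m ∣? k ⌋) (γ-∼ f g t)

-- The dropped part is the sum over functions with `m ∣ γ f`. Grouped by classes it consists of
-- terms `γ r * φ r`, each divisible by `m`.
D↘Ec : ∀ m (φ : BF n → ℕ) → Invariant φ → sumL (D n) φ ↘[ m ] sumL (Ec n m) φ
D↘Ec {n} m φ inv = sumL (filterᵇ (divisible m) (D n)) φ
  , subst (m ∣_) (sym (sumL-orbits (divisible m) φ (divisible-invariant m) inv))
      (sumL-∣ _ λ r r∈ → ∣m⇒∣m*n (φ r)
        (toWitness (proj₂ (∈-filter⁻ (T? ∘ divisible m) {xs = R n} r∈))))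
  , sumL-partition (divisible m) (D n) φ

-- Iterated sums

-- The first entry is summed outermost, so `sumV X 6 F-vec` unfolds to `F6 X`.
sumV : List A → ∀ k → (Vec A k → ℕ) → ℕ
sumV X zero    φ = φ []
sumV X (suc k) φ = sumL X λ x → sumV X k λ v → φ (x ∷ v)

sumV-cong : ∀ (X : List A) k {φ ψ : Vec A k → ℕ} → (∀ v → φ v ≡ ψ v) → sumV X k φ ≡ sumV X k ψ
sumV-cong X zero    e = e []
sumV-cong X (suc k) e = sumL-cong′ X λ x → sumV-cong X k λ v → e (x ∷ v)

sumV-*ˡ : ∀ (X : List A) k c (φ : Vec A k → ℕ) → sumV X k (λ v → c * φ v) ≡ c * sumV X k φ
sumV-*ˡ X zero    c φ = refl
sumV-*ˡ X (suc k) c φ = trans (sumL-cong′ X λ x → sumV-*ˡ X k c _) (sumL-*ˡ X c _)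

sumV-*ʳ : ∀ (X : List A) k c (φ : Vec A k → ℕ) → sumV X k (λ v → φ v * c) ≡ sumV X k φ * c
sumV-*ʳ X zero    c φ = refl
sumV-*ʳ X (suc k) c φ = trans (sumL-cong′ X λ x → sumV-*ʳ X k c _) (sumL-*ʳ X c _)

sumL-sumV-swap : ∀ (X : List A) (Y : List B) k (φ : A → Vec B k → ℕ) →
  sumL X (λ x → sumV Y k (φ x)) ≡ sumV Y k (λ v → sumL X λ x → φ x v)
sumL-sumV-swap X Y zero    φ = refl
sumL-sumV-swap X Y (suc k) φ =
  trans (sumL-swap X Y _) (sumL-cong′ Y λ y → sumL-sumV-swap X Y k λ x v → φ x (y ∷ v))

MatchesV : Perm n → (φ ψ : Vec (BF n) k → ℕ) → Set
MatchesV π φ ψ = ∀ v w → Pointwise (_≈[ π ]_) v w → φ v ≡ ψ w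

InvariantV : (Vec (BF n) k → ℕ) → Set
InvariantV φ = ∀ π → MatchesV π φ φ

sumV-closed : ∀ (π : Perm n) X → Closed π X → ∀ k {φ ψ : Vec (BF n) k → ℕ} →
  MatchesV π φ ψ → sumV X k φ ≡ sumV X k ψ
sumV-closed π X c zero    m = m [] [] []
sumV-closed π X c (suc k) m = c _ _ λ f g e → sumV-closed π X c k λ v w es → m (f ∷ v) (g ∷ w) (e ∷ es)

-- `Ec n m` is cut out of `D n` by a condition on `γ`, which is constant on classes.
Ec-closed : ∀ m (π : Perm n) → Closed π (Ec n m)
Ec-closed m π φ ψ e = sumL-filter-D π
  (λ f g t → cong not (divisible-invariant m f g (∼⁺ π f g t))) e

-- Once the first coordinate is restricted to Ec, the sum over it is moved inside: it is then an
-- invariant function of the remaining coordinates, to which the induction hypothesis applies.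
sumV-D↘Ec : ∀ m k (φ : Vec (BF n) k → ℕ) → InvariantV φ → sumV (D n) k φ ↘[ m ] sumV (Ec n m) k φ
sumV-D↘Ec m zero φ inv = 0 , m ∣0 , sym (+-identityʳ (φ []))
sumV-D↘Ec {n} m (suc k) φ inv = ↘-trans
  (D↘Ec m _ λ f g t → let π , e = ∼⁻ f g t in
    sumV-closed π (D n) (D-closed π) k λ v w es → inv π (f ∷ v) (g ∷ w) (e ∷ es))
  (subst₂ (λ x y → x ↘[ m ] y)
    (sym (sumL-sumV-swap (Ec n m) (D n) k _)) (sym (sumL-sumV-swap (Ec n m) (Ec n m) k _))
    (sumV-D↘Ec m k _ λ π v w es →
      Ec-closed m π _ _ λ f g e → inv π (f ∷ v) (g ∷ w) (e ∷ es)))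

-- Splitting off four coordinates

-- Each split doubles the number of nested sums. At depth 4 this unfolds to 16 sums over `allBF n`
-- in index order, that is, to a `sumV` of a function of `assemble`.
sumBlocks : ∀ k {n} → (BF (k + n) → ℕ) → ℕ
sumBlocks zero    φ = sumL (allBF _) φ
sumBlocks (suc k) φ = sumBlocks k λ g → sumBlocks k λ h → φ (g ▹ h)

sumBlocks-cong : ∀ k {φ ψ : BF (k + n) → ℕ} → (∀ f → φ f ≡ ψ f) → sumBlocks k φ ≡ sumBlocks k ψ
sumBlocks-cong zero    e = sumL-cong′ (allBF _) e
sumBlocks-cong (suc k) e = sumBlocks-cong k λ g → sumBlocks-cong k λ h → e (g ▹ h)

sumL-allBF-blocks : ∀ k (φ : BF (k + n) → ℕ) → Extensional φ →
  sumL (allBF (k + n)) φ ≡ sumBlocks k φ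
sumL-allBF-blocks zero φ ext = refl
sumL-allBF-blocks {n} (suc k) φ ext = begin
  sumL (allBF (suc k + n)) φ
    ≡⟨ sumL-allBF-suc ext ⟩
  sumL (allBF (k + n)) (λ g → sumL (allBF (k + n)) λ h → φ (g ▹ h))
    ≡⟨ sumL-cong′ (allBF (k + n)) (λ g → sumL-allBF-blocks k _ λ e → ext (▹-cong (λ _ → refl) e)) ⟩
  sumL (allBF (k + n)) (λ g → sumBlocks k λ h → φ (g ▹ h))
    ≡⟨ sumL-allBF-blocks k _ (λ e → sumBlocks-cong k λ h → ext (▹-cong e λ _ → refl)) ⟩
  sumBlocks (suc k) φ ∎
  where open ≡-Reasoning

allV : (A → Bool) → Vec A k → Bool
allV p []      = true
allV p (x ∷ v) = p x ∧ allV p v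

sumV-filter : ∀ (p : A → Bool) X k (φ : Vec A k → ℕ) →
  sumV (filterᵇ p X) k φ ≡ sumV X k (λ v → 𝟙 (allV p v) * φ v)
sumV-filter p X zero    φ = sym (+-identityʳ (φ []))
sumV-filter p X (suc k) φ = trans (sumL-filter p X _) (sumL-cong′ X λ x → begin
  𝟙 (p x) * sumV (filterᵇ p X) k (λ v → φ (x ∷ v))          ≡⟨ cong (𝟙 (p x) *_) (sumV-filter p X k _) ⟩
  𝟙 (p x) * sumV X k (λ v → 𝟙 (allV p v) * φ (x ∷ v))       ≡⟨ sumV-*ˡ X k (𝟙 (p x)) _ ⟨
  sumV X k (λ v → 𝟙 (p x) * (𝟙 (allV p v) * φ (x ∷ v)))     ≡⟨ sumV-cong X k (λ v →
    trans (sym (*-assoc (𝟙 (p x)) (𝟙 (allV p v)) _)) (cong (_* φ (x ∷ v)) (sym (𝟙-∧ (p x) (allV p v))))) ⟩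
  sumV X k (λ v → 𝟙 (p x ∧ allV p v) * φ (x ∷ v))           ∎)
  where open ≡-Reasoning

sumV-insertAt : ∀ (X : List A) k (i : Fin (suc k)) (φ : Vec A (suc k) → ℕ) →
  sumV X (suc k) φ ≡ sumL X (λ x → sumV X k λ v → φ (insertAt v i x))
sumV-insertAt X k zero φ = refl
sumV-insertAt X (suc k) (suc i) φ =
  trans (sumL-cong′ X λ y → sumV-insertAt X k i λ v → φ (y ∷ v)) (sumL-swap X X _)

-- Lehmer codes of the permutations of k letters.
Code : ℕ → Set
Code zero    = ⊤
Code (suc k) = Fin (suc k) × Code k

-- The digit of an entry counts the later entries that end up to its left; the digits in `by-level`
-- are these counts for the passage from level order to index order.
reorder : Code k → Vec A k → Vec A k
reorder c       []      = []
reorder (i , c) (x ∷ v) = insertAt (reorder c v) i x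

-- Finite sums commute: `sumV-insertAt` moves one summation variable to its place, and induction
-- handles the rest.
sumV-reorder : ∀ (X : List A) k (c : Code k) (φ : Vec A k → ℕ) →
  sumV X k φ ≡ sumV X k (φ ∘ reorder c)
sumV-reorder X zero    c       φ = refl
sumV-reorder X (suc k) (i , c) φ =
  trans (sumV-insertAt X k i φ) (sumL-cong′ X λ x → sumV-reorder X k c λ v → φ (insertAt v i x))

-- The block of S ⊆ {1,2,3,4} stands at the index whose binary digits are the indicator of S.
assemble : Vec (BF n) 16 → BF (4 + n)
assemble (g₀ ∷ g₁ ∷ g₂ ∷ g₃ ∷ g₄ ∷ g₅ ∷ g₆ ∷ g₇ ∷ g₈ ∷ g₉ ∷ g₁₀ ∷ g₁₁ ∷ g₁₂ ∷ g₁₃ ∷ g₁₄ ∷ g₁₅ ∷ []) =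
  (((g₀ ▹ g₁) ▹ (g₂ ▹ g₃)) ▹ ((g₄ ▹ g₅) ▹ (g₆ ▹ g₇))) ▹
  (((g₈ ▹ g₉) ▹ (g₁₀ ▹ g₁₁)) ▹ ((g₁₂ ▹ g₁₃) ▹ (g₁₄ ▹ g₁₅)))

-- Lists the blocks of size 2 first (in the order a, b, c, d, e, f), then size 4 and 3, then 0 and 1.
by-level : Code 16
by-level =
  # 12 , # 10 , # 9 , # 6 , # 5 , # 3 , # 9 , # 8 , # 7 , # 6 , # 4 , # 0 , # 3 , # 2 , # 1 , # 0 , tt

-- `F` as a count of blocks.

sumV-*-sumL : ∀ (X : List A) k (φ : Vec A k → ℕ) (f : A → ℕ) →
  sumV X k φ * sumL X f ≡ sumV X k (λ v → sumL X λ x → φ v * f x)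
sumV-*-sumL X k φ f =
  trans (sym (sumV-*ʳ X k (sumL X f) φ)) (sumV-cong X k λ v → sym (sumL-*ˡ X (φ v) f))

-- Bracketed like the products of four `re` factors in `Upart` and `Lpart`, with the condition on
-- the summation variable in front.
quad : (p q₁ q₂ q₃ q₄ : Bool) → Bool
quad p q₁ q₂ q₃ q₄ = p ∧ (((q₁ ∧ q₂) ∧ q₃) ∧ q₄)

quad⁺ : ∀ {p q₁ q₂ q₃ q₄} → T p → T q₁ → T q₂ → T q₃ → T q₄ → T (quad p q₁ q₂ q₃ q₄)
quad⁺ t t₁ t₂ t₃ t₄ = ∧⁺ t (∧⁺ (∧⁺ (∧⁺ t₁ t₂) t₃) t₄)

quad⁻ : ∀ p q₁ q₂ q₃ {q₄} → T (quad p q₁ q₂ q₃ q₄) → T q₁ × T q₂ × T q₃ × T q₄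
quad⁻ p q₁ q₂ q₃ t =
  let t₁₂₃ , t₄ = ∧⁻ ((q₁ ∧ q₂) ∧ q₃) (proj₂ (∧⁻ p t))
      t₁₂ , t₃  = ∧⁻ (q₁ ∧ q₂) t₁₂₃
      t₁ , t₂   = ∧⁻ q₁ t₁₂
  in  t₁ , t₂ , t₃ , t₄

𝟙-quad : ∀ p q₁ q₂ q₃ q₄ → 𝟙 (quad p q₁ q₂ q₃ q₄) ≡ 𝟙 p * (𝟙 q₁ * 𝟙 q₂ * 𝟙 q₃ * 𝟙 q₄)
𝟙-quad p q₁ q₂ q₃ q₄ = trans (𝟙-∧ p _) (cong (𝟙 p *_)
  (trans (𝟙-∧ ((q₁ ∧ q₂) ∧ q₃) q₄) (cong (_* 𝟙 q₄)
  (trans (𝟙-∧ (q₁ ∧ q₂) q₃) (cong (_* 𝟙 q₃) (𝟙-∧ q₁ q₂))))))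

quadV : (p : A → Bool) (q₁ q₂ q₃ q₄ : A → A → Bool) → Vec A 5 → Bool
quadV p q₁ q₂ q₃ q₄ (u ∷ z₁ ∷ z₂ ∷ z₃ ∷ z₄ ∷ []) =
  quad (p u) (q₁ u z₁) (q₂ u z₂) (q₃ u z₃) (q₄ u z₄)

-- A product of four counts counts quadruples; together with `u` this turns `Upart` and `Lpart` into
-- numbers of 5-tuples.
sumL-lengths : ∀ X (p : A → Bool) (q₁ q₂ q₃ q₄ : A → A → Bool) →
  sumL (filterᵇ p X) (λ u → length (filterᵇ (q₁ u) X) * length (filterᵇ (q₂ u) X)
                          * length (filterᵇ (q₃ u) X) * length (filterᵇ (q₄ u) X))
  ≡ sumV X 5 (𝟙 ∘ quadV p q₁ q₂ q₃ q₄)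
sumL-lengths {A} X p q₁ q₂ q₃ q₄ = trans (sumL-filter p X _) (sumL-cong′ X λ u →
  trans (cong (𝟙 (p u) *_) (lengths u)) (trans (sym (sumV-*ˡ X 4 (𝟙 (p u)) (φ₄ u)))
    (sumV-cong X 4 {φ = λ v → 𝟙 (p u) * φ₄ u v} {ψ = λ v → 𝟙 (quadV p q₁ q₂ q₃ q₄ (u ∷ v))} λ where
      (z₁ ∷ z₂ ∷ z₃ ∷ z₄ ∷ []) → sym (𝟙-quad (p u) (q₁ u z₁) (q₂ u z₂) (q₃ u z₃) (q₄ u z₄)))))
  where
  -- With the partial products named on vectors, each use of `sumV-*-sumL` below adds an innermost
  -- sum, and its result is the next `sumV` by unfolding.
  φ₁ : A → Vec A 1 → ℕ
  φ₁ u (z₁ ∷ []) = 𝟙 (q₁ u z₁)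
  φ₂ : A → Vec A 2 → ℕ
  φ₂ u (z₁ ∷ z₂ ∷ []) = 𝟙 (q₁ u z₁) * 𝟙 (q₂ u z₂)
  φ₃ : A → Vec A 3 → ℕ
  φ₃ u (z₁ ∷ z₂ ∷ z₃ ∷ []) = 𝟙 (q₁ u z₁) * 𝟙 (q₂ u z₂) * 𝟙 (q₃ u z₃)
  φ₄ : A → Vec A 4 → ℕ
  φ₄ u (z₁ ∷ z₂ ∷ z₃ ∷ z₄ ∷ []) = 𝟙 (q₁ u z₁) * 𝟙 (q₂ u z₂) * 𝟙 (q₃ u z₃) * 𝟙 (q₄ u z₄)
  lengths : ∀ u → length (filterᵇ (q₁ u) X) * length (filterᵇ (q₂ u) X)
                * length (filterᵇ (q₃ u) X) * length (filterᵇ (q₄ u) X) ≡ sumV X 4 (φ₄ u)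
  lengths u = begin
    length (filterᵇ (q₁ u) X) * length (filterᵇ (q₂ u) X)
      * length (filterᵇ (q₃ u) X) * length (filterᵇ (q₄ u) X)
      ≡⟨ cong₂ _*_ (cong₂ _*_ (cong₂ _*_ (length-filter (q₁ u) X) (length-filter (q₂ u) X))
           (length-filter (q₃ u) X)) (length-filter (q₄ u) X) ⟩
    sumV X 1 (φ₁ u) * S (q₂ u) * S (q₃ u) * S (q₄ u)
      ≡⟨ cong (λ s → s * S (q₃ u) * S (q₄ u)) (sumV-*-sumL X 1 (φ₁ u) (𝟙 ∘ q₂ u)) ⟩
    sumV X 2 (φ₂ u) * S (q₃ u) * S (q₄ u)
      ≡⟨ cong (_* S (q₄ u)) (sumV-*-sumL X 2 (φ₂ u) (𝟙 ∘ q₃ u)) ⟩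
    sumV X 3 (φ₃ u) * S (q₄ u)
      ≡⟨ sumV-*-sumL X 3 (φ₃ u) (𝟙 ∘ q₄ u) ⟩
    sumV X 4 (φ₄ u) ∎
    where
    open ≡-Reasoning
    S : (A → Bool) → ℕ
    S q = sumL X (𝟙 ∘ q)

between : (x y z : BF n) → Bool
between x y z = (x ≤F z) ∧ (z ≤F y)

between⁺ : (x y z : BF n) → x ⊑ z → z ⊑ y → T (between x y z)
between⁺ x y z p q = ∧⁺ (≤F⁺ x z p) (≤F⁺ z y q)

between⁻ : (x y z : BF n) → T (between x y z) → x ⊑ z × z ⊑ y
between⁻ x y z t = let p , q = ∧⁻ (x ≤F z) t in ≤F⁻ x z p , ≤F⁻ z y q

-- With `a` to `f` as the blocks 12, 13, 14, 23, 24, 34, the five entries for `upper` are the blocks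
-- 1234, 123, 124, 134, 234, and those for `lower` are the blocks of the empty set, 1, 2, 3, 4.
upper lower : Vec (BF n) 6 → Vec (BF n) 5 → Bool
upper (a ∷ b ∷ c ∷ d ∷ e ∷ f ∷ []) = quadV ((a ∣∣ b ∣∣ c ∣∣ d ∣∣ e ∣∣ f) ≤F_)
  (between (a ∣∣ b ∣∣ d)) (between (a ∣∣ c ∣∣ e)) (between (b ∣∣ c ∣∣ f)) (between (d ∣∣ e ∣∣ f))
lower (a ∷ b ∷ c ∷ d ∷ e ∷ f ∷ []) = quadV (_≤F (a & b & c & d & e & f))
  (λ u → between u (a & b & c)) (λ u → between u (a & d & e))
  (λ u → between u (b & d & f)) (λ u → between u (c & e & f))

F-vec : Vec (BF n) 6 → ℕ
F-vec (a ∷ b ∷ c ∷ d ∷ e ∷ f ∷ []) = F a b c d e f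

-- Given the six middle blocks, the upper and lower 5-tuples are chosen independently, so the
-- product of the two counts is a count of pairs.
F-sum : (v : Vec (BF n) 6) →
  F-vec v ≡ sumV (D n) 5 (λ w → sumV (D n) 5 λ w′ → 𝟙 (upper v w ∧ lower v w′))
F-sum {n} v@(a ∷ b ∷ c ∷ d ∷ e ∷ f ∷ []) = begin
  Upart a b c d e f * Lpart a b c d e f
    ≡⟨ cong₂ _*_ (sumL-lengths (D n) ((a ∣∣ b ∣∣ c ∣∣ d ∣∣ e ∣∣ f) ≤F_)
           (between (a ∣∣ b ∣∣ d)) (between (a ∣∣ c ∣∣ e)) (between (b ∣∣ c ∣∣ f)) (between (d ∣∣ e ∣∣ f)))
         (sumL-lengths (D n) (_≤F (a & b & c & d & e & f))
           (λ u → between u (a & b & c)) (λ u → between u (a & d & e))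
           (λ u → between u (b & d & f)) (λ u → between u (c & e & f))) ⟩
  sumV (D n) 5 (𝟙 ∘ upper v) * sumV (D n) 5 (𝟙 ∘ lower v)
    ≡⟨ sumV-*ʳ (D n) 5 _ (𝟙 ∘ upper v) ⟨
  sumV (D n) 5 (λ w → 𝟙 (upper v w) * sumV (D n) 5 (𝟙 ∘ lower v))
    ≡⟨ sumV-cong (D n) 5 (λ w → trans (sym (sumV-*ˡ (D n) 5 (𝟙 (upper v w)) (𝟙 ∘ lower v)))
         (sumV-cong (D n) 5 λ w′ → sym (𝟙-∧ (upper v w) (lower v w′)))) ⟩
  sumV (D n) 5 (λ w → sumV (D n) 5 λ w′ → 𝟙 (upper v w ∧ lower v w′)) ∎
  where open ≡-Reasoning

-- Monotonicity of the assembled function.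

∣∣-lub : {x y w : BF n} → x ⊑ w → y ⊑ w → (x ∣∣ y) ⊑ w
∣∣-lub {x = x} p q u t with x u in eq
... | true  = p u (subst T (sym eq) tt)
... | false = q u t

⊑-∣∣ˡ : (x y : BF n) {w : BF n} → (x ∣∣ y) ⊑ w → x ⊑ w
⊑-∣∣ˡ x y p u t = p u (Equivalence.from T-∨ (inj₁ t))

⊑-∣∣ʳ : (x y : BF n) {w : BF n} → (x ∣∣ y) ⊑ w → y ⊑ w
⊑-∣∣ʳ x y p u t = p u (Equivalence.from (T-∨ {x u}) (inj₂ t))

&-glb : {x y w : BF n} → w ⊑ x → w ⊑ y → w ⊑ (x & y)
&-glb p q u t = ∧⁺ (p u t) (q u t)

⊑-&ˡ : (x y : BF n) {w : BF n} → w ⊑ (x & y) → w ⊑ x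
⊑-&ˡ x y p u t = proj₁ (∧⁻ (x u) (p u t))

⊑-&ʳ : (x y : BF n) {w : BF n} → w ⊑ (x & y) → w ⊑ y
⊑-&ʳ x y p u t = proj₂ (∧⁻ (x u) (p u t))

split₃-∣∣ : (x y z : BF n) {w : BF n} → (x ∣∣ y ∣∣ z) ⊑ w → x ⊑ w × y ⊑ w × z ⊑ w
split₃-∣∣ x y z p = ⊑-∣∣ˡ x (y ∣∣ z) p , ⊑-∣∣ˡ y z yz , ⊑-∣∣ʳ y z yz
  where yz = ⊑-∣∣ʳ x (y ∣∣ z) p

split₃-& : (x y z : BF n) {w : BF n} → w ⊑ (x & y & z) → w ⊑ x × w ⊑ y × w ⊑ z
split₃-& x y z p = ⊑-&ˡ x (y & z) p , ⊑-&ˡ y z yz , ⊑-&ʳ y z yz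
  where yz = ⊑-&ʳ x (y & z) p

≤P-refl : (u : Point n) → T (u ≤P u)
≤P-refl []      = tt
≤P-refl (x ∷ u) = ∧⁺ (≤b⁺ {x} id) (≤P-refl u)

▹-⊑ : {g h g′ h′ : BF n} → g ⊑ g′ → h ⊑ h′ → (g ▹ h) ⊑ (g′ ▹ h′)
▹-⊑ p q (false ∷ u) = p u
▹-⊑ p q (true ∷ u)  = q u

-- In the mixed case the path goes from `u` to `v` inside the lower half and then up to the other
-- half at `v`.
Mono-▹ : {g h : BF n} → Mono g → Mono h → g ⊑ h → Mono (g ▹ h)
Mono-▹ mg mh gh (false ∷ u) (false ∷ v) p t = mg u v p t
Mono-▹ mg mh gh (false ∷ u) (true ∷ v)  p t = gh v (mg u v p t)
Mono-▹ mg mh gh (true ∷ u)  (true ∷ v)  p t = mh u v p t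

≤P-++ : ∀ (s t : Point k) (u v : Point n) → T (s ≤P t) → T (u ≤P v) → T ((s ++ᵛ u) ≤P (t ++ᵛ v))
≤P-++ []      []      u v p q = q
≤P-++ (x ∷ s) (y ∷ t) u v p q = let p₀ , p₁ = ∧⁻ (x ≤b y) p in ∧⁺ p₀ (≤P-++ s t u v p₁ q)

allV⁺ : (p : A → Bool) (v : Vec A k) → All (T ∘ p) v → T (allV p v)
allV⁺ p []      []       = tt
allV⁺ p (x ∷ v) (t ∷ ts) = ∧⁺ t (allV⁺ p v ts)

allV⁻ : (p : A → Bool) (v : Vec A k) → T (allV p v) → All (T ∘ p) v
allV⁻ p []      t = []
allV⁻ p (x ∷ v) t = let s , ts = ∧⁻ (p x) t in s ∷ allV⁻ p v ts

-- The eight `between` conditions carry four edges of the 4-cube each, 32 in all. Taking the vector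
-- in the order 6, 5, 5 matches the nested sums of `F-sum`.
edges : Vec (BF n) 16 → Bool
edges (a ∷ b ∷ c ∷ d ∷ e ∷ f ∷ u ∷ z₁ ∷ z₂ ∷ z₃ ∷ z₄ ∷ l ∷ w₁ ∷ w₂ ∷ w₃ ∷ w₄ ∷ []) =
  upper (a ∷ b ∷ c ∷ d ∷ e ∷ f ∷ []) (u ∷ z₁ ∷ z₂ ∷ z₃ ∷ z₄ ∷ []) ∧
  lower (a ∷ b ∷ c ∷ d ∷ e ∷ f ∷ []) (l ∷ w₁ ∷ w₂ ∷ w₃ ∷ w₄ ∷ [])

module _ (a b c d e f u z₁ z₂ z₃ z₄ l w₁ w₂ w₃ w₄ : BF n) where

  private
    v : Vec (BF n) 16
    v = a ∷ b ∷ c ∷ d ∷ e ∷ f ∷ u ∷ z₁ ∷ z₂ ∷ z₃ ∷ z₄ ∷ l ∷ w₁ ∷ w₂ ∷ w₃ ∷ w₄ ∷ []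

    whole : BF (4 + n)
    whole = assemble (reorder by-level v)

  -- For a concrete vertex `s`, `block s` computes to one of the sixteen variables, so every
  -- required inequality is an instance of the monotonicity of `whole`.
  assemble-mono⁻ : Mono whole → T (allV isMonotone v ∧ edges v)
  assemble-mono⁻ m = ∧⁺
    (allV⁺ isMonotone v
      ( mono s₁₂ ∷ mono s₁₃ ∷ mono s₁₄ ∷ mono s₂₃ ∷ mono s₂₄ ∷ mono s₃₄
      ∷ mono s₁₂₃₄ ∷ mono s₁₂₃ ∷ mono s₁₂₄ ∷ mono s₁₃₄ ∷ mono s₂₃₄
      ∷ mono s₀ ∷ mono s₁ ∷ mono s₂ ∷ mono s₃ ∷ mono s₄ ∷ []))
    (∧⁺
      (quad⁺
        (≤F⁺ (a ∣∣ b ∣∣ c ∣∣ d ∣∣ e ∣∣ f) u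
          (∣∣-lub {x = a} (edge s₁₂ s₁₂₃₄) (∣∣-lub {x = b} (edge s₁₃ s₁₂₃₄)
          (∣∣-lub {x = c} (edge s₁₄ s₁₂₃₄) (∣∣-lub {x = d} (edge s₂₃ s₁₂₃₄)
          (∣∣-lub {x = e} (edge s₂₄ s₁₂₃₄) (edge s₃₄ s₁₂₃₄)))))))
        (triangle s₁₂ s₁₃ s₂₃ s₁₂₃) (triangle s₁₂ s₁₄ s₂₄ s₁₂₄)
        (triangle s₁₃ s₁₄ s₃₄ s₁₃₄) (triangle s₂₃ s₂₄ s₃₄ s₂₃₄))
      (quad⁺
        (≤F⁺ l (a & b & c & d & e & f)
          (&-glb (edge s₀ s₁₂) (&-glb (edge s₀ s₁₃) (&-glb (edge s₀ s₁₄)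
          (&-glb (edge s₀ s₂₃) (&-glb (edge s₀ s₂₄) (edge s₀ s₃₄)))))))
        (star s₁₂ s₁₃ s₁₄ s₁) (star s₁₂ s₂₃ s₂₄ s₂)
        (star s₁₃ s₂₃ s₃₄ s₃) (star s₁₄ s₂₄ s₃₄ s₄)))
    where
    s₀    = false ∷ false ∷ false ∷ false ∷ []
    s₁    = true  ∷ false ∷ false ∷ false ∷ []
    s₂    = false ∷ true  ∷ false ∷ false ∷ []
    s₃    = false ∷ false ∷ true  ∷ false ∷ []
    s₄    = false ∷ false ∷ false ∷ true  ∷ []
    s₁₂   = true  ∷ true  ∷ false ∷ false ∷ []
    s₁₃   = true  ∷ false ∷ true  ∷ false ∷ []
    s₁₄   = true  ∷ false ∷ false ∷ true  ∷ []
    s₂₃   = false ∷ true  ∷ true  ∷ false ∷ []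
    s₂₄   = false ∷ true  ∷ false ∷ true  ∷ []
    s₃₄   = false ∷ false ∷ true  ∷ true  ∷ []
    s₁₂₃  = true  ∷ true  ∷ true  ∷ false ∷ []
    s₁₂₄  = true  ∷ true  ∷ false ∷ true  ∷ []
    s₁₃₄  = true  ∷ false ∷ true  ∷ true  ∷ []
    s₂₃₄  = false ∷ true  ∷ true  ∷ true  ∷ []
    s₁₂₃₄ = true  ∷ true  ∷ true  ∷ true  ∷ []
    block : Point 4 → BF n
    block s x = whole (s ++ᵛ x)
    mono : ∀ s → T (isMonotone (block s))
    mono s = isMonotone⁺ (block s) λ x y p → m (s ++ᵛ x) (s ++ᵛ y) (≤P-++ s s x y (≤P-refl s) p)
    -- Any comparable vertices are allowed, also two levels apart. For concrete vertices the
    -- implicit order proof has type `⊤` and is filled in automatically.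
    edge : ∀ s t {p : T (s ≤P t)} → block s ⊑ block t
    edge s t {p} x = m (s ++ᵛ x) (t ++ᵛ x) (≤P-++ s t x x p (≤P-refl x))
    triangle : ∀ p q r s {ps : T (p ≤P s)} {qs : T (q ≤P s)} {rs : T (r ≤P s)} {s⊤ : T (s ≤P s₁₂₃₄)} →
      T (between (block p ∣∣ block q ∣∣ block r) (block s₁₂₃₄) (block s))
    triangle p q r s {ps} {qs} {rs} {s⊤} = between⁺ (block p ∣∣ block q ∣∣ block r) (block s₁₂₃₄) (block s)
      (∣∣-lub {x = block p} (edge p s {ps}) (∣∣-lub {x = block q} (edge q s {qs}) (edge r s {rs})))
      (edge s s₁₂₃₄ {s⊤})
    star : ∀ p q r s {sp : T (s ≤P p)} {sq : T (s ≤P q)} {sr : T (s ≤P r)} {⊥s : T (s₀ ≤P s)} →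
      T (between (block s₀) (block p & block q & block r) (block s))
    star p q r s {sp} {sq} {sr} {⊥s} = between⁺ (block s₀) (block p & block q & block r) (block s)
      (edge s₀ s {⊥s}) (&-glb (edge s p {sp}) (&-glb (edge s q {sq}) (edge s r {sr})))

  assemble-mono⁺ : T (allV isMonotone v ∧ edges v) → Mono whole
  assemble-mono⁺ t = glue (allV⁻ isMonotone v (proj₁ (∧⁻ (allV isMonotone v) t)))
    where
    join = a ∣∣ b ∣∣ c ∣∣ d ∣∣ e ∣∣ f
    meet = a & b & c & d & e & f
    up×low = ∧⁻ (upper (a ∷ b ∷ c ∷ d ∷ e ∷ f ∷ []) (u ∷ z₁ ∷ z₂ ∷ z₃ ∷ z₄ ∷ []))
      (proj₂ (∧⁻ (allV isMonotone v) t))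

    triangle : ∀ x y z {w} → T (between (x ∣∣ y ∣∣ z) u w) → (x ⊑ w × y ⊑ w × z ⊑ w) × w ⊑ u
    triangle x y z {w} s = let p , q = between⁻ (x ∣∣ y ∣∣ z) u w s in split₃-∣∣ x y z p , q
    star : ∀ x y z {w} → T (between l (x & y & z) w) → (w ⊑ x × w ⊑ y × w ⊑ z) × l ⊑ w
    star x y z {w} s = let p , q = between⁻ l (x & y & z) w s in split₃-& x y z q , p

    glue : All (T ∘ isMonotone) v → Mono whole
    glue (ma ∷ mb ∷ mc ∷ md ∷ me ∷ mf ∷ mu ∷ mz₁ ∷ mz₂ ∷ mz₃ ∷ mz₄ ∷ ml ∷ mw₁ ∷ mw₂ ∷ mw₃ ∷ mw₄ ∷ []) =
      let t₁ , t₂ , t₃ , t₄ = quad⁻ (join ≤F u) (between (a ∣∣ b ∣∣ d) u z₁)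
            (between (a ∣∣ c ∣∣ e) u z₂) (between (b ∣∣ c ∣∣ f) u z₃) (proj₁ up×low)
          r₁ , r₂ , r₃ , r₄ = quad⁻ (l ≤F meet) (between l (a & b & c) w₁)
            (between l (a & d & e) w₂) (between l (b & d & f) w₃) (proj₂ up×low)
          (az₁ , bz₁ , dz₁) , z₁u = triangle a b d t₁
          (az₂ , cz₂ , ez₂) , z₂u = triangle a c e t₂
          (bz₃ , cz₃ , fz₃) , z₃u = triangle b c f t₃
          (dz₄ , ez₄ , fz₄) , z₄u = triangle d e f t₄
          (w₁a , w₁b , w₁c) , lw₁ = star a b c r₁
          (w₂a , w₂d , w₂e) , lw₂ = star a d e r₂
          (w₃b , w₃d , w₃f) , lw₃ = star b d f r₃
          (w₄c , w₄e , w₄f) , lw₄ = star c e f r₄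
          m = λ {g} → isMonotone⁻ {n} g
      -- The innermost `Mono-▹` use the edges in direction 4, the next layers those in directions 3
      -- and 2, and the outermost those in direction 1; `▹-⊑` splits each comparison of halves into
      -- such edges.
      in  Mono-▹
            (Mono-▹
              (Mono-▹ (Mono-▹ (m ml) (m mw₄) lw₄) (Mono-▹ (m mw₃) (m mf) w₃f) (▹-⊑ lw₃ w₄f))
              (Mono-▹ (Mono-▹ (m mw₂) (m me) w₂e) (Mono-▹ (m md) (m mz₄) dz₄) (▹-⊑ w₂d ez₄))
              (▹-⊑ (▹-⊑ lw₂ w₄e) (▹-⊑ w₃d fz₄)))
            (Mono-▹
              (Mono-▹ (Mono-▹ (m mw₁) (m mc) w₁c) (Mono-▹ (m mb) (m mz₃) bz₃) (▹-⊑ w₁b cz₃))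
              (Mono-▹ (Mono-▹ (m ma) (m mz₂) az₂) (Mono-▹ (m mz₁) (m mu) z₁u) (▹-⊑ az₁ z₂u))
              (▹-⊑ (▹-⊑ w₁a cz₂) (▹-⊑ bz₁ z₃u)))
            (▹-⊑ (▹-⊑ (▹-⊑ lw₁ w₄c) (▹-⊑ w₃b fz₃)) (▹-⊑ (▹-⊑ w₂a ez₂) (▹-⊑ dz₁ z₄u)))

-- Monotonicity of the assembled function is monotonicity of all blocks together with `edges`; the
-- first conjunct turns the sums over `allBF n` into sums over `D n`.
d-blocks : ∀ n → d (4 + n) ≡ sumV (D n) 16 (𝟙 ∘ edges)
d-blocks n = begin
  d (4 + n)
    ≡⟨ length-filter isMonotone (allBF (4 + n)) ⟩
  sumL (allBF (4 + n)) (𝟙 ∘ isMonotone)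
    ≡⟨ sumL-allBF-blocks 4 (𝟙 ∘ isMonotone) isMonotone-ext ⟩
  sumV (allBF n) 16 (𝟙 ∘ isMonotone ∘ assemble)
    ≡⟨ sumV-reorder (allBF n) 16 by-level (𝟙 ∘ isMonotone ∘ assemble) ⟩
  sumV (allBF n) 16 (𝟙 ∘ isMonotone ∘ assemble ∘ reorder by-level)
    ≡⟨ sumV-cong (allBF n) 16 (λ v → trans (cong 𝟙 (isMonotone-assemble v)) (𝟙-∧ (allV isMonotone v) (edges v))) ⟩
  sumV (allBF n) 16 (λ v → 𝟙 (allV isMonotone v) * 𝟙 (edges v))
    ≡⟨ sumV-filter isMonotone (allBF n) 16 (𝟙 ∘ edges) ⟨
  sumV (D n) 16 (𝟙 ∘ edges) ∎
  where
  open ≡-Reasoning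
  isMonotone-ext : Extensional (𝟙 ∘ isMonotone {4 + n})
  isMonotone-ext {f} {g} e = cong 𝟙 (T-ext
    (λ t → isMonotone⁺ g (Mono-≗ e (isMonotone⁻ f t)))
    (λ t → isMonotone⁺ f (Mono-≗ (λ u → sym (e u)) (isMonotone⁻ g t))))
  isMonotone-assemble : (v : Vec (BF n) 16) →
    isMonotone (assemble (reorder by-level v)) ≡ allV isMonotone v ∧ edges v
  isMonotone-assemble v@(a ∷ b ∷ c ∷ d ∷ e ∷ f ∷ u ∷ z₁ ∷ z₂ ∷ z₃ ∷ z₄ ∷ l ∷ w₁ ∷ w₂ ∷ w₃ ∷ w₄ ∷ []) = T-ext
    (λ t → assemble-mono⁻ a b c d e f u z₁ z₂ z₃ z₄ l w₁ w₂ w₃ w₄ (isMonotone⁻ whole t))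
    (λ t → isMonotone⁺ whole (assemble-mono⁺ a b c d e f u z₁ z₂ z₃ z₄ l w₁ w₂ w₃ w₄ t))
    where whole = assemble (reorder by-level v)

-- The congruences modulo `m`.

d≡F6 : ∀ n → d (n + 4) ≡ F6 (D n)
d≡F6 n = begin
  -- Coordinates are split off at the front, where `4 + n` reduces.
  d (n + 4)                    ≡⟨ cong d (+-comm n 4) ⟩
  d (4 + n)                    ≡⟨ d-blocks n ⟩
  -- The 16 sums unfold into 6 outer sums and two groups of 5, as in `F-sum`.
  sumV (D n) 16 (𝟙 ∘ edges)    ≡⟨ sumV-cong (D n) 6 F-sum ⟨
  F6 (D n)                     ∎
  where open ≡-Reasoning

F-vec-invariant : InvariantV (F-vec {n})
F-vec-invariant π (a ∷ b ∷ c ∷ d ∷ e ∷ f ∷ []) (a′ ∷ b′ ∷ c′ ∷ d′ ∷ e′ ∷ f′ ∷ [])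
  (p ∷ q ∷ r ∷ s ∷ t ∷ w ∷ []) =
  F-≈ π {a} {b} {c} {d} {e} {f} {a′} {b′} {c′} {d′} {e′} {f′} p q r s t w

-- Integer divisibility is divisibility of absolute values, so it suffices to compute the difference
-- as `z`.
↘⇒mod : ∀ m x y → x ↘[ m ] y → x ≡ y [mod m ]
↘⇒mod m x y (z , m∣z , refl) = subst (m ∣_) (cong ℤ.∣_∣ (sym (begin
  ℤ.+ (y + z) ℤ.- ℤ.+ y      ≡⟨ ℤ.m-n≡m⊖n (y + z) y ⟩
  (y + z) ℤ.⊖ y              ≡⟨ ℤ.⊖-≥ (m≤m+n y z) ⟩
  ℤ.+ (y + z ∸ y)            ≡⟨ cong ℤ.+_ (m+n∸m≡n y z) ⟩
  ℤ.+ z                      ∎))) m∣z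
  where open ≡-Reasoning

-- The inner sum over five arguments in `Ec n m` is a class function of `a`, since `Ec n m` is
-- closed and `F` is invariant; `sumL-orbits` then yields the factor `γ a`, which is moved inside.
Ec-orbits : ∀ n m → F6 (Ec n m) ≡ sumL (REc n m) λ a → sumL (Ec n m) λ b → sumL (Ec n m) λ c →
  sumL (Ec n m) λ d → sumL (Ec n m) λ e → sumL (Ec n m) λ f → γ a * F a b c d e f
Ec-orbits n m = trans
  (sumL-orbits (not ∘ divisible m) (λ a → sumV (Ec n m) 5 λ v → F-vec (a ∷ v))
    (λ f g t → cong not (divisible-invariant m f g t))
    (λ f g t → let π , e = ∼⁻ f g t in sumV-closed π (Ec n m) (Ec-closed m π) 5
      λ v w es → F-vec-invariant π (f ∷ v) (g ∷ w) (e ∷ es)))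
  (sumL-cong′ (REc n m) λ a → sym (sumV-*ˡ (Ec n m) 5 (γ a) λ v → F-vec (a ∷ v)))

theorem14 : (n m : ℕ) → 1 < m →
    (d (n + 4) ≡ F6 (D n) [mod m ]) ×
    (F6 (D n) ≡ F6 (Ec n m) [mod m ]) ×
    (d (n + 4) ≡ sumL (REc n m) (λ a → sumL (Ec n m) λ b → sumL (Ec n m) λ c →
    sumL (Ec n m) λ d → sumL (Ec n m) λ e → sumL (Ec n m) λ f →
    γ a * F a b c d e f) [mod m ])
theorem14 n m _ =
    ↘⇒mod m (d (n + 4)) (F6 (D n)) (0 , m ∣0 , trans (d≡F6 n) (sym (+-identityʳ _)))
  , ↘⇒mod m (F6 (D n)) (F6 (Ec n m)) D↘Ec⁶
  -- Both ends of `D↘Ec⁶` are replaced along equalities of natural numbers.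
  , ↘⇒mod m (d (n + 4)) _ (subst₂ (λ x y → x ↘[ m ] y) (sym (d≡F6 n)) (Ec-orbits n m) D↘Ec⁶)
  where
  D↘Ec⁶ : F6 (D n) ↘[ m ] F6 (Ec n m)
  D↘Ec⁶ = sumV-D↘Ec {n} m 6 F-vec F-vec-invariant
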